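{- There is a wild left adjoint that fails to preserve colimits. Concretely, let $\mathcal E_{new}$, $\Lambda:\mathcal E_{new}\to\mathcal E_{new}$, the one-vertex one-edge graph $\Gamma$, the diagram $F:\Gamma\to\mathcal E_{new}$ and the cocone $\mathcal K$ under $F$ be as defined in the context. Then $\mathcal E_{new}$ is a wild category, $\Lambda$ is a wild functor, there is a wild adjunction $\Lambda\dashv\Lambda$, and $\mathcal K$ is colimiting, but the cocone $\Lambda(\mathcal K)$ under $\Lambda(F)$ is not colimiting.
   Context: Everything is inside Book HoTT; $p\cdot q$ is path concatenation, $\mathsf{ap}_f$ the action of $f$ on paths. Wild category: a type $\mathsf{Ob}$ of objects, a family $\mathsf{hom}$ of types (not assumed to be sets), identities $\mathsf{id}$, composition $\circ$, unit laws (paths), and associativity $\mathsf{assoc}(f,g,h):(f\circ g)\circ h=f\circ(g\circ h)$; no further coherence. Wild functor $F$: functions on objects and on morphisms, with paths $F_\circ(g,f):F(g)\circ F(f)=F(g\circ f)$ and $F_{\mathsf{id}}(X):\mathsf{id}_{F(X)}=F(\mathsf{id}_X)$. Wild adjunction $L\dashv R$: equivalences $\psi:\mathsf{hom}_{\mathcal D}(L(A),X)\simeq\mathsf{hom}_{\mathcal C}(A,R(X))$ with paths $\mathsf{nat}_{cod}(g,h):R(g)\circ\psi(h)=\psi(g\circ h)$ and $\mathsf{nat}_{dom}(f,h):\psi(h)\circ f=\psi(h\circ L(f))$ for all suitable $g,h,f$. Graph $\Gamma$: a type $\Gamma_0$ and a family of types $\Gamma_1(i,j)$. Diagram $F$: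 objects $F_i$, morphisms $F_{i,j,g}:\mathsf{hom}(F_i,F_j)$ for $g:\Gamma_1(i,j)$. Cocone $(C,r,K)$ under $F$: an object $C$, morphisms $r_i:\mathsf{hom}(F_i,C)$, paths $K_{i,j,g}:r_j\circ F_{i,j,g}=r_i$. It is colimiting if for every object $X$ the map $\mathsf{hom}(C,X)\to\sum_{s:\prod_i\mathsf{hom}(F_i,X)}\prod_{i,j,g}s_j\circ F_{i,j,g}=s_i$, $f\mapsto(\lambda i.f\circ r_i,\ \mathsf{assoc}(f,r_j,F_{i,j,g})\cdot\mathsf{ap}_{f\circ- }(K_{i,j,g}))$ is an equivalence. For a functor $L$, $L(F)$ is the image diagram and $L(C,r,K):=(L(C),L(r_i),L_\circ(r_j,F_{i,j,g})\cdot\mathsf{ap}_L(K_{i,j,g}))$. $S^1$ is the circle with point $\mathsf{base}$ and path $\mathsf{loop}:\mathsf{base}=\mathsf{base}$. $\tau:\prod_{x:S^1}x=x$ is the function defined by $S^1$-induction with $\tau(\mathsf{base})\equiv\mathsf{loop}$. $\mathcal E_{new}$: objects $\mathbf 2=\{0,1\}$; $\mathsf{hom}(0,0):=\mathbf 1$, $\mathsf{hom}(0,1):=S^1$, $\mathsf{hom}(1,0):=\mathbf 1$, $\mathsf{hom}(1,1):=(S^1\to S^1)$. Composition: $g\circ f$ is ordinary composition of functions for $g,f:\mathsf{hom}(1,1)$; $h\circ x:=h(x)$ for $h:\mathsf{hom}(1,1)$, $x:\mathsf{hom}(0,1)$; $y\circ x$ is the constant map at $y$ for $y:\mathsf{hom}(0,1)$,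 $x:\mathsf{hom}(1,0)$; $y\circ x:=y$ for $y:\mathsf{hom}(0,1)$, $x:\mathsf{hom}(0,0)$; any composite with codomain $0$ is the unique element of $\mathbf 1$. Identities are the obvious ones; unit and associativity laws hold definitionally after case splitting on objects (take $\mathsf{refl}$). $\Gamma$ has one vertex $v$ and one edge $\ell$ from $v$ to $v$; $F(v):=0$, $F(\ell):=\mathsf{id}_0$. $\mathcal K:=(1,\mathsf{base},\mathsf{loop})$. $\Lambda:\mathcal E_{new}\to\mathcal E_{new}$ is the identity on objects and morphisms (with trivial identity law), with $\Lambda_\circ(g,f):=\tau(g)^{ -1}$ if $g:\mathsf{hom}(0,1)$ and $f:\mathsf{hom}(0,0)$, and $\Lambda_\circ(g,f):=\mathsf{refl}_{g\circ f}$ otherwise. -}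

{-# OPTIONS --without-K --safe #-}
-- Homotopy type theory is rendered as intensional type theory without K, with
-- the two further ingredients of Book HoTT used here given by the types
-- `Univalence ℓ` and `Circle`, to be assumed wherever they are needed.
module Defs where

open import Level using (Level; _⊔_; suc; 0ℓ; Setω)
open import Data.Bool.Base using (Bool; true; false)
open import Data.Product.Base using (Σ; Σ-syntax; _×_; _,_)
open import Data.Unit.Base using (⊤; tt)
open import Function.Properties.Inverse.HalfAdjointEquivalence using (_≃_)
open import Relation.Binary.PropositionalEquality
open import Relation.Nullary.Negation.Core using (¬_)

private
  variable
    a b ℓ o h o′ h′ v e v′ e′ : Level

-- The data making a given function the `to` field of a half adjoint
-- equivalence in the sense of the library's `_≃_`.

record IsEquiv {A : Set a} {B : Set b} (f : A → B) : Set (a ⊔ b) where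
  field
    from             : B → A
    left-inverse-of  : ∀ x → from (f x) ≡ x
    right-inverse-of : ∀ y → f (from y) ≡ y
    left-right       : ∀ x → cong f (left-inverse-of x) ≡ right-inverse-of (f x)

idToEquiv : {A B : Set ℓ} → A ≡ B → A ≃ B
idToEquiv refl = record
  { to               = λ x → x
  ; from             = λ x → x
  ; left-inverse-of  = λ _ → refl
  ; right-inverse-of = λ _ → refl
  ; left-right       = λ _ → refl
  }

Univalence : ∀ ℓ → Set (suc ℓ)
Univalence ℓ = {A B : Set ℓ} → IsEquiv (idToEquiv {A = A} {B = B})

-- In Book HoTT the computation rule at the point is judgmental; here it is the
-- path `ind-base`, along which the rule for `loop` has to be conjugated.

record Circle : Setω where
  field
    S¹   : Set
    base : S¹
    loop : base ≡ base
    ind  : ∀ {ℓ} (P : S¹ → Set ℓ) (p : P base) → subst P loop p ≡ p → ∀ x → P x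
    ind-base : ∀ {ℓ} (P : S¹ → Set ℓ) (p : P base) (q : subst P loop p ≡ p) →
               ind P p q base ≡ p
    ind-loop : ∀ {ℓ} (P : S¹ → Set ℓ) (p : P base) (q : subst P loop p ≡ p) →
               trans (dcong (ind P p q) loop) (ind-base P p q)
                 ≡ trans (cong (subst P loop) (ind-base P p q)) q

record WildCategory o h : Set (suc (o ⊔ h)) where
  infixr 9 _∘_
  field
    Ob    : Set o
    hom   : Ob → Ob → Set h
    id    : ∀ X → hom X X
    _∘_   : ∀ {X Y Z} → hom Y Z → hom X Y → hom X Z
    idˡ   : ∀ {X Y} (f : hom X Y) → id Y ∘ f ≡ f
    idʳ   : ∀ {X Y} (f : hom X Y) → f ∘ id X ≡ f
    assoc : ∀ {W X Y Z} (f : hom Y Z) (g : hom X Y) (h : hom W X) →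
            (f ∘ g) ∘ h ≡ f ∘ (g ∘ h)

record WildFunctor (𝒞 : WildCategory o h) (𝒟 : WildCategory o′ h′) :
                   Set (o ⊔ h ⊔ o′ ⊔ h′) where
  private
    module C = WildCategory 𝒞
    module D = WildCategory 𝒟
  field
    F₀   : C.Ob → D.Ob
    F₁   : ∀ {X Y} → C.hom X Y → D.hom (F₀ X) (F₀ Y)
    F-∘  : ∀ {X Y Z} (g : C.hom Y Z) (f : C.hom X Y) →
           F₁ g D.∘ F₁ f ≡ F₁ (g C.∘ f)
    F-id : ∀ X → D.id (F₀ X) ≡ F₁ (C.id X)

infix 4 _⊣_

record _⊣_ {𝒞 : WildCategory o h} {𝒟 : WildCategory o′ h′}
           (L : WildFunctor 𝒞 𝒟) (R : WildFunctor 𝒟 𝒞) :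
           Set (o ⊔ h ⊔ o′ ⊔ h′) where
  private
    module C = WildCategory 𝒞
    module D = WildCategory 𝒟
    module L = WildFunctor L
    module R = WildFunctor R
  field
    equiv : ∀ {A X} → D.hom (L.F₀ A) X ≃ C.hom A (R.F₀ X)

  ψ : ∀ {A X} → D.hom (L.F₀ A) X → C.hom A (R.F₀ X)
  ψ = _≃_.to equiv

  field
    nat-cod : ∀ {A X Y} (g : D.hom X Y) (h : D.hom (L.F₀ A) X) →
              R.F₁ g C.∘ ψ h ≡ ψ (g D.∘ h)
    nat-dom : ∀ {A B X} (f : C.hom A B) (h : D.hom (L.F₀ B) X) →
              ψ h C.∘ f ≡ ψ (h D.∘ L.F₁ f)

record Graph v e : Set (suc (v ⊔ e)) where
  field
    Vertex : Set v
    Edge   : Vertex → Vertex → Set e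

record Diagram (Γ : Graph v e) (𝒞 : WildCategory o h) :
               Set (v ⊔ e ⊔ o ⊔ h) where
  open Graph Γ
  open WildCategory 𝒞
  field
    obj : Vertex → Ob
    mor : ∀ {i j} → Edge i j → hom (obj i) (obj j)

module _ {Γ : Graph v e} {𝒞 : WildCategory o h} where
  open Graph Γ
  open WildCategory 𝒞

  CoconeOn : Diagram Γ 𝒞 → Ob → Set (v ⊔ e ⊔ h)
  CoconeOn F X =
    Σ[ s ∈ (∀ i → hom (obj i) X) ] (∀ i j (g : Edge i j) → s j ∘ mor g ≡ s i)
    where open Diagram F

  record Cocone (F : Diagram Γ 𝒞) : Set (v ⊔ e ⊔ o ⊔ h) where
    open Diagram F
    field
      C : Ob
      r : ∀ i → hom (obj i) C
      K : ∀ i j (g : Edge i j) → r j ∘ mor g ≡ r i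

  postcomp : {F : Diagram Γ 𝒞} (𝒦 : Cocone F) (X : Ob) →
             hom (Cocone.C 𝒦) X → CoconeOn F X
  postcomp {F} 𝒦 X f =
    (λ i → f ∘ r i) ,
    (λ i j g → trans (assoc f (r j) (mor g)) (cong (f ∘_) (K i j g)))
    where
    open Diagram F
    open Cocone 𝒦

  IsColimiting : {F : Diagram Γ 𝒞} → Cocone F → Set (v ⊔ e ⊔ o ⊔ h)
  IsColimiting 𝒦 = ∀ X → IsEquiv (postcomp 𝒦 X)

module _ {Γ : Graph v e} {𝒞 : WildCategory o h} {𝒟 : WildCategory o′ h′}
         (L : WildFunctor 𝒞 𝒟) where
  open WildFunctor L

  mapDiagram : Diagram Γ 𝒞 → Diagram Γ 𝒟
  mapDiagram F = record
    { obj = λ i → F₀ (obj i)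
    ; mor = λ g → F₁ (mor g)
    }
    where open Diagram F

  mapCocone : {F : Diagram Γ 𝒞} → Cocone F → Cocone (mapDiagram F)
  mapCocone {F} 𝒦 = record
    { C = F₀ C
    ; r = λ i → F₁ (r i)
    ; K = λ i j g → trans (F-∘ (r j) (mor g)) (cong F₁ (K i j g))
    }
    where
    open Diagram F
    open Cocone 𝒦

IsLeftAdjoint : {𝒞 : WildCategory o h} {𝒟 : WildCategory o′ h′} →
                WildFunctor 𝒞 𝒟 → Set (o ⊔ h ⊔ o′ ⊔ h′)
IsLeftAdjoint {𝒞 = 𝒞} {𝒟 = 𝒟} L = Σ[ R ∈ WildFunctor 𝒟 𝒞 ] L ⊣ R

FailsToPreserveColimits : ∀ v e {𝒞 : WildCategory o h} {𝒟 : WildCategory o′ h′} →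
                          WildFunctor 𝒞 𝒟 → Set (suc (v ⊔ e) ⊔ o ⊔ h ⊔ o′ ⊔ h′)
FailsToPreserveColimits v e {𝒞 = 𝒞} L =
  Σ[ Γ ∈ Graph v e ] Σ[ F ∈ Diagram Γ 𝒞 ] Σ[ 𝒦 ∈ Cocone F ]
    (IsColimiting 𝒦 × ¬ IsColimiting (mapCocone L 𝒦))

subst-≡-diag : {A : Set a} {x y : A} (p : x ≡ y) (q : x ≡ x) →
               subst (λ z → z ≡ z) p q ≡ trans (sym p) (trans q p)
subst-≡-diag refl q = sym (trans-reflʳ q)

subst-≡-diag-self : {A : Set a} {x : A} (p : x ≡ x) →
                    subst (λ z → z ≡ z) p p ≡ p
subst-≡-diag-self p =
  trans (subst-≡-diag p p)
        (trans (sym (trans-assoc (sym p))) (cong (λ q → trans q p) (trans-symˡ p)))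

pattern 𝟎 = false
pattern 𝟏 = true

module Construction (𝕊 : Circle) where
  open Circle 𝕊 public

  τ : (x : S¹) → x ≡ x
  τ = ind (λ x → x ≡ x) loop (subst-≡-diag-self loop)

  homE : Bool → Bool → Set
  homE 𝟎 𝟎 = ⊤
  homE 𝟎 𝟏 = S¹
  homE 𝟏 𝟎 = ⊤
  homE 𝟏 𝟏 = S¹ → S¹

  idE : ∀ X → homE X X
  idE 𝟎 = tt
  idE 𝟏 = λ x → x

  compE : ∀ X Y Z → homE Y Z → homE X Y → homE X Z
  compE 𝟎 Y 𝟎 _ _ = tt
  compE 𝟏 Y 𝟎 _ _ = tt
  compE 𝟎 𝟎 𝟏 y _ = y
  compE 𝟏 𝟎 𝟏 y _ = λ _ → y
  compE 𝟎 𝟏 𝟏 h x = h x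
  compE 𝟏 𝟏 𝟏 g f = λ x → g (f x)

  idˡE : ∀ X Y (f : homE X Y) → compE X Y Y (idE Y) f ≡ f
  idˡE 𝟎 𝟎 _ = refl
  idˡE 𝟎 𝟏 _ = refl
  idˡE 𝟏 𝟎 _ = refl
  idˡE 𝟏 𝟏 _ = refl

  idʳE : ∀ X Y (f : homE X Y) → compE X X Y f (idE X) ≡ f
  idʳE 𝟎 𝟎 _ = refl
  idʳE 𝟎 𝟏 _ = refl
  idʳE 𝟏 𝟎 _ = refl
  idʳE 𝟏 𝟏 _ = refl

  assocE : ∀ W X Y Z (f : homE Y Z) (g : homE X Y) (h : homE W X) →
           compE W X Z (compE X Y Z f g) h ≡ compE W Y Z f (compE W X Y g h)
  assocE 𝟎 X Y 𝟎 _ _ _ = refl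
  assocE 𝟏 X Y 𝟎 _ _ _ = refl
  assocE 𝟎 𝟎 𝟎 𝟏 _ _ _ = refl
  assocE 𝟎 𝟎 𝟏 𝟏 _ _ _ = refl
  assocE 𝟎 𝟏 𝟎 𝟏 _ _ _ = refl
  assocE 𝟎 𝟏 𝟏 𝟏 _ _ _ = refl
  assocE 𝟏 𝟎 𝟎 𝟏 _ _ _ = refl
  assocE 𝟏 𝟎 𝟏 𝟏 _ _ _ = refl
  assocE 𝟏 𝟏 𝟎 𝟏 _ _ _ = refl
  assocE 𝟏 𝟏 𝟏 𝟏 _ _ _ = refl

  ℰnew : WildCategory 0ℓ 0ℓ
  ℰnew = record
    { Ob    = Bool
    ; hom   = homE
    ; id    = idE
    ; _∘_   = λ {X} {Y} {Z} → compE X Y Z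
    ; idˡ   = λ {X} {Y} → idˡE X Y
    ; idʳ   = λ {X} {Y} → idʳE X Y
    ; assoc = λ {W} {X} {Y} {Z} → assocE W X Y Z
    }

  Λ-∘ : ∀ X Y Z (g : homE Y Z) (f : homE X Y) →
        compE X Y Z g f ≡ compE X Y Z g f
  Λ-∘ 𝟎 𝟎 𝟏 g _ = sym (τ g)
  Λ-∘ _ _ _ _ _ = refl

  Λ : WildFunctor ℰnew ℰnew
  Λ = record
    { F₀   = λ X → X
    ; F₁   = λ f → f
    ; F-∘  = λ {X} {Y} {Z} → Λ-∘ X Y Z
    ; F-id = λ _ → refl
    }

  Γ : Graph 0ℓ 0ℓ
  Γ = record { Vertex = ⊤ ; Edge = λ _ _ → ⊤ }

  F : Diagram Γ ℰnew
  F = record { obj = λ _ → 𝟎 ; mor = λ _ → idE 𝟎 }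

  𝒦 : Cocone F
  𝒦 = record { C = 𝟏 ; r = λ _ → base ; K = λ _ _ _ → loop }

{-# OPTIONS --without-K #-}

-- The two triangles of a wild adjunction only involve the action on objects and
-- morphisms, so Λ, being the identity there, is adjoint to itself through the
-- identity equivalences. That 𝒦 is colimiting is the universal property of the
-- circle. In Λ(𝒦) the path is τ(base)⁻¹ · loop = refl, so every cocone it induces
-- carries a trivial path, whereas the cocone 𝒦 carries loop, which is not refl.
module Submission where

open import Defs
open import Level using (Level; 0ℓ)
open import Data.Bool.Base using (Bool; true; false; not)
open import Data.Bool.Properties using (not-involutive)
open import Data.Product.Base using (Σ-syntax; _×_; _,_; proj₁; proj₂)
open import Data.Unit.Base using (tt)
open import Data.Unit.Properties using (_≟_)
open import Axiom.UniquenessOfIdentityProofs using (module Decidable⇒UIP)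
open import Function.Base using (_∘′_)
open import Function.Bundles using (mk↔ₛ′)
open import Function.Properties.Inverse.HalfAdjointEquivalence using (_≃_; ↔⇒≃)
open import Relation.Binary.PropositionalEquality
open import Relation.Nullary.Negation.Core using (¬_)

private
  variable
    a b ℓ : Level
    A : Set a
    B : Set b

qinv⇒isEquiv : (f : A → B) (g : B → A) → (∀ x → g (f x) ≡ x) →
               (∀ y → f (g y) ≡ y) → IsEquiv f
qinv⇒isEquiv f g gf fg = record
  { from             = E.from
  ; left-inverse-of  = E.left-inverse-of
  ; right-inverse-of = E.right-inverse-of
  ; left-right       = E.left-right
  }
  where module E = _≃_ (↔⇒≃ (mk↔ₛ′ f g fg gf))

Path : Set a → Set a
Path A = Σ[ x ∈ A ] Σ[ y ∈ A ] x ≡ y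

const-path≃ : A ≃ Path A
const-path≃ = record
  { to               = λ x → x , x , refl
  ; from             = proj₁
  ; left-inverse-of  = λ _ → refl
  ; right-inverse-of = λ { (_ , _ , refl) → refl }
  ; left-right       = λ _ → refl
  }

module _ (univalence : Univalence ℓ) where

  -- By univalence `e` comes from a path of types, and for the reflexive path `k` can be `h` itself.
  -- Inverting `e` pointwise would need function extensionality, which is the goal here.
  factor-through-≃ : {A B : Set ℓ} {X : Set a} (e : A ≃ B) (h : X → B) →
                     Σ[ k ∈ (X → A) ] h ≡ _≃_.to e ∘′ k
  factor-through-≃ {A = A} {X = X} e h =
    subst (λ e′ → Σ[ k ∈ (X → A) ] h ≡ _≃_.to e′ ∘′ k)
          (right-inverse-of e) (along (from e) h)
    where
    open IsEquiv univalence
    along : {B : Set ℓ} (p : A ≡ B) (h : X → B) →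
            Σ[ k ∈ (X → A) ] h ≡ _≃_.to (idToEquiv p) ∘′ k
    along refl h = h , refl

  -- A homotopy is a map into the path space, which factors through the constant
  -- paths; on these the two endpoints agree definitionally.
  funext : {X : Set a} {B : Set ℓ} {f g : X → B} → (∀ x → f x ≡ g x) → f ≡ g
  funext {f = f} {g} f~g =
    trans (cong (source ∘′_) h≡) (sym (cong (target ∘′_) h≡))
    where
    source target : Path B → B
    source (x , _ , _) = x
    target (_ , y , _) = y
    h≡ = proj₂ (factor-through-≃ const-path≃ (λ x → f x , g x , f~g x))

not≃ : Bool ≃ Bool
not≃ = ↔⇒≃ (mk↔ₛ′ not not not-involutive not-involutive)

-- Negation is an equivalence, hence a path `Bool ≡ Bool`; were it `refl`, negation would fix
-- `true`.
Bool-loop≢refl : Univalence 0ℓ → ¬ (∀ (p : Bool ≡ Bool) → p ≡ refl)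
Bool-loop≢refl univalence trivial = true≢false (cong (λ e → _≃_.to e true) id≡not)
  where
  open IsEquiv (univalence {Bool} {Bool})
  id≡not : idToEquiv refl ≡ not≃
  id≡not = trans (cong idToEquiv (sym (trivial (from not≃)))) (right-inverse-of not≃)
  true≢false : ¬ (true ≡ false)
  true≢false ()

subst-const : {x y : A} (p : x ≡ y) (z : B) → subst (λ _ → B) p z ≡ z
subst-const refl _ = refl

dcong-const : (f : A → B) {x y : A} (p : x ≡ y) →
              dcong f p ≡ trans (subst-const p (f x)) (cong f p)
dcong-const f refl = refl

subst-const-natural : {x y : A} (p : x ≡ y) {z w : B} (q : z ≡ w) →
  trans (cong (subst (λ _ → B) p) q) (subst-const p w) ≡ trans (subst-const p z) q
subst-const-natural refl refl = refl

subst-≡-square : {f g : A → B} {x y : A} (p : x ≡ y) {q : f x ≡ g x} {r : f y ≡ g y} →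
                 trans (cong f p) r ≡ trans q (cong g p) →
                 subst (λ z → f z ≡ g z) p q ≡ r
subst-≡-square refl {q} eq = sym (trans eq (trans-reflʳ q))

module CircleProperties (𝕊 : Circle) where
  open Circle 𝕊

  rec : (x : A) → x ≡ x → S¹ → A
  rec {A = A} x p = ind (λ _ → A) x (trans (subst-const loop x) p)

  rec-base : (x : A) (p : x ≡ x) → rec x p base ≡ x
  rec-base {A = A} x p = ind-base (λ _ → A) x (trans (subst-const loop x) p)

  -- This is `ind-loop` for a constant family: `dcong` becomes `cong` preceded by `c`, and
  -- naturality of `subst-const` brings `c` to the front of the other side too, where it cancels.
  rec-loop : (x : A) (p : x ≡ x) →
             trans (cong (rec x p) loop) (rec-base x p) ≡ trans (rec-base x p) p
  rec-loop {A = A} x p = trans-injectiveʳ c (begin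
    trans c (trans (cong f loop) β)             ≡⟨ trans-assoc c ⟨
    trans (trans c (cong f loop)) β             ≡⟨ cong (λ q → trans q β) (dcong-const f loop) ⟨
    trans (dcong f loop) β                      ≡⟨ ind-loop (λ _ → A) x (trans (subst-const loop x) p) ⟩
    trans β′ (trans (subst-const loop x) p)     ≡⟨ trans-assoc β′ ⟨
    trans (trans β′ (subst-const loop x)) p     ≡⟨ cong (λ q → trans q p) (subst-const-natural loop β) ⟩
    trans (trans c β) p                         ≡⟨ trans-assoc c ⟩
    trans c (trans β p)                         ∎)
    where
    open ≡-Reasoning
    f  = rec x p
    β  = rec-base x p
    β′ = cong (subst (λ _ → A) loop) β
    c  = subst-const loop (f base)

  -- By circle induction: the two maps agree at `base` through `rec-base`, and `rec-loop` is exactly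
  -- the square that `subst-≡-square` asks for over `loop`.
  rec-unique : (f : S¹ → A) → ∀ x → rec (f base) (cong f loop) x ≡ f x
  rec-unique f =
    ind _ (rec-base (f base) (cong f loop))
          (subst-≡-square loop (rec-loop (f base) (cong f loop)))

  -- Recursion into the universe sends `loop` to any given `p : Bool ≡ Bool`, up to conjugation, so
  -- a trivial `loop` would make every such `p` trivial.
  loop≢refl : Univalence 0ℓ → ¬ (loop ≡ refl)
  loop≢refl univalence loop≡refl = Bool-loop≢refl univalence λ p →
    trans-injectiveʳ (rec-base Bool p) (begin
      trans (rec-base Bool p) p                            ≡⟨ rec-loop Bool p ⟨
      trans (cong (rec Bool p) loop) (rec-base Bool p)     ≡⟨ cong (λ l → trans (cong (rec Bool p) l) (rec-base Bool p)) loop≡refl ⟩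
      rec-base Bool p                                      ≡⟨ trans-reflʳ _ ⟨
      trans (rec-base Bool p) refl                         ∎)
    where open ≡-Reasoning

module _ (univalence : Univalence 0ℓ) (𝕊 : Circle) where
  open Construction 𝕊
  open CircleProperties 𝕊

  -- A cocone on `𝟏` is a free loop in `S¹`; the hypothesis has the shape of `rec-loop`.
  cocone-≡ : {x y : S¹} (β : x ≡ y) {p : x ≡ x} {q : y ≡ y} →
             trans p β ≡ trans β q →
             _≡_ {A = CoconeOn F 𝟏} ((λ _ → x) , λ _ _ _ → p) ((λ _ → y) , λ _ _ _ → q)
  cocone-≡ refl {p} eq =
    cong (λ r → (λ _ → _) , λ _ _ _ → r) (trans (sym (trans-reflʳ p)) eq)

  loop-of : (s : CoconeOn F 𝟏) → proj₁ s tt ≡ proj₁ s tt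
  loop-of (_ , K) = K tt tt tt

  𝒦-colimiting : IsColimiting 𝒦
  𝒦-colimiting 𝟎 = qinv⇒isEquiv (postcomp 𝒦 𝟎) (λ _ → tt) (λ _ → refl)
    -- Here the cocone path lives in the unit type, a set by decidable equality.
    λ (s , K) → cong (λ p → s , λ _ _ _ → p) (Decidable⇒UIP.≡-irrelevant _≟_ _ (K tt tt tt))
  𝒦-colimiting 𝟏 = qinv⇒isEquiv (postcomp 𝒦 𝟏)
    (λ s → rec (proj₁ s tt) (loop-of s))
    (λ f → funext univalence (rec-unique f))
    (λ s → cocone-≡ (rec-base (proj₁ s tt) (loop-of s)) (rec-loop (proj₁ s tt) (loop-of s)))

  -- The left side is what the cocone path of `mapCocone Λ 𝒦` computes to.
  τ⁻¹∙loop≡refl : trans (sym (τ base)) (cong (λ x → x) loop) ≡ refl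
  τ⁻¹∙loop≡refl = begin
    trans (sym (τ base)) (cong (λ x → x) loop) ≡⟨ cong₂ (λ p q → trans (sym p) q) τ-base (cong-id loop) ⟩
    trans (sym loop) loop                      ≡⟨ trans-symˡ loop ⟩
    refl                                       ∎
    where
    open ≡-Reasoning
    τ-base : τ base ≡ loop
    τ-base = ind-base (λ x → x ≡ x) loop (subst-≡-diag-self loop)

  Λ𝒦-not-colimiting : ¬ IsColimiting (mapCocone Λ 𝒦)
  Λ𝒦-not-colimiting colimiting =
    loop≢refl univalence
      -- The cocone induced by `from cocone` has a trivial loop, and `right-inverse-of` identifies
      -- it with `cocone`, whose loop is `loop`.
      (subst (λ s → loop-of s ≡ refl) (right-inverse-of cocone)
             (cong (cong (from cocone)) τ⁻¹∙loop≡refl))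
    where
    open IsEquiv (colimiting 𝟏)
    cocone : CoconeOn F 𝟏
    cocone = (λ _ → base) , λ _ _ _ → loop

mainTheorem2 : (∀ ℓ → Univalence ℓ) → (𝕊 : Circle) →
    let open Construction 𝕊 in
    (Σ[ 𝒞 ∈ WildCategory 0ℓ 0ℓ ] Σ[ 𝒟 ∈ WildCategory 0ℓ 0ℓ ] Σ[ L ∈ WildFunctor 𝒞 𝒟 ]
    (IsLeftAdjoint L × FailsToPreserveColimits 0ℓ 0ℓ L))
    × ((Λ ⊣ Λ) × IsColimiting 𝒦 × ¬ IsColimiting (mapCocone Λ 𝒦))
mainTheorem2 univalence 𝕊 =
  (ℰnew , ℰnew , Λ , (Λ , adjoint) , Γ , F , 𝒦 , colim , ¬colim) , adjoint , colim , ¬colim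
  where
  open Construction 𝕊
  adjoint : Λ ⊣ Λ
  adjoint = record
    { equiv   = idToEquiv refl
    ; nat-cod = λ _ _ → refl
    ; nat-dom = λ _ _ → refl
    }
  colim   = 𝒦-colimiting (univalence 0ℓ) 𝕊
  ¬colim  = Λ𝒦-not-colimiting (univalence 0ℓ) 𝕊
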